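{- Let $D$ be a sink-free digraph that contains no anti-claw (i.e. no induced subdigraph isomorphic to $\vec{K}_{3,1}$). Then $D$ has a quasi-kernel of size at most $|V(D)|/2$.
   Context: A quasi-kernel of a digraph $D$ is an independent set $Q\subseteq V(D)$ such that for every vertex $v\in V(D)\setminus Q$ there is a directed path with one or two arcs from $v$ to some vertex of $Q$. A sink is a vertex with no out-neighbour; $D$ is sink-free if it has no sink. $\vec{K}_{3,1}$ (the anti-claw) is the digraph on four vertices $a_1,a_2,a_3,c$ whose arcs are exactly $a_1c,a_2c,a_3c$. -}

module Defs where

open import Data.Nat using (ℕ)
open import Data.Fin using (Fin)
open import Data.Fin.Subset using (Subset; _∈_; _∉_)
open import Data.Product using (Σ; ∃; _×_)
open import Relation.Nullary using (¬_; Dec)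
open import Relation.Binary.PropositionalEquality using (_≡_; _≢_)

-- A (finite) digraph on vertex set Fin n: a loopless arc relation.
-- Arc is decidable (a finite digraph has a decidable arc set).
-- Digons (arcs in both directions) are allowed; parallel arcs are
-- irrelevant for all notions here.
record Digraph (n : ℕ) : Set₁ where
  field
    Arc      : Fin n → Fin n → Set
    arc?     : ∀ u v → Dec (Arc u v)
    loopless : ∀ v → ¬ Arc v v
open Digraph public

module _ {n : ℕ} (D : Digraph n) where

  Sink : Fin n → Set
  Sink v = ∀ w → ¬ Arc D v w

  SinkFree : Set
  SinkFree = ∀ v → ¬ Sink v

  Independent : Subset n → Set
  Independent Q = ∀ u v → u ∈ Q → v ∈ Q → ¬ Arc D u v

  Reach≤2 : Fin n → Fin n → Set
  Reach≤2 v w = Arc D v w ⊎' Σ (Fin n) (λ x → Arc D v x × Arc D x w)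
    where
    open import Data.Sum renaming (_⊎_ to _⊎'_)

  QuasiKernel : Subset n → Set
  QuasiKernel Q = Independent Q
                × (∀ v → v ∉ Q → Σ (Fin n) (λ q → q ∈ Q × Reach≤2 v q))

  InducedAntiClaw : Fin n → Fin n → Fin n → Fin n → Set
  InducedAntiClaw a₁ a₂ a₃ c =
      a₁ ≢ a₂ × a₁ ≢ a₃ × a₂ ≢ a₃ × a₁ ≢ c × a₂ ≢ c × a₃ ≢ c
    × Arc D a₁ c × Arc D a₂ c × Arc D a₃ c
    × ¬ Arc D c a₁ × ¬ Arc D c a₂ × ¬ Arc D c a₃
    × ¬ Arc D a₁ a₂ × ¬ Arc D a₂ a₁
    × ¬ Arc D a₁ a₃ × ¬ Arc D a₃ a₁
    × ¬ Arc D a₂ a₃ × ¬ Arc D a₃ a₂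

  AntiClawFree : Set
  AntiClawFree = ∀ a₁ a₂ a₃ c → ¬ InducedAntiClaw a₁ a₂ a₃ c

{-# OPTIONS --safe #-}

-- For a quasi-kernel Q write N⁻(Q) for the set of vertices with an arc into Q,
-- and call the vertices outside Q ∪ N⁻(Q) remote.  Choose Q with a minimal set
-- of remote vertices.  Then every remote c has a v ∈ N⁻(Q) all of whose
-- out-neighbours in Q are in-neighbours of c; otherwise replacing Q ∩ N⁻(c) by
-- c would leave fewer remote vertices.  Pick a function sel : N⁻(Q) → Q along
-- arcs, and let A ⊆ Q consist of the image of sel and of the vertices of Q with
-- no out-neighbour in N⁻(Q).  A is again a quasi-kernel.  A vertex of A outside
-- the image of sel has a remote out-neighbour c.  Without an anti-claw c has at
-- most two in-neighbours in Q, and one of them is the value of sel at the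
-- vertex v above, so different such vertices have different c.  Hence A injects
-- into the complement of Q.
module Submission where

open import Defs
open import Data.Nat using (ℕ; _+_; _*_; _∸_; _≤_; z≤n; s≤s)
open import Data.Nat.Properties
  using (≤-trans; +-identityʳ; +-monoʳ-≤; m+[n∸m]≡n; module ≤-Reasoning)
open import Data.Fin using (Fin; suc)
open import Data.Fin.Properties using (_≟_; any?; all?; 0≢1+n; suc-injective)
open import Data.Fin.Subset using (Subset; inside; outside; _∈_; _∉_; _⊆_; _⊂_; _-_; ⊤; ∁; ∣_∣)
open import Data.Fin.Subset.Properties
  using (_∈?_; ∈⊤; x∈p∧x≢y⇒x∈p-y; x∈p⇒∣p-x∣<∣p∣; ∣p∣≤n; ∣∁p∣≡n∸∣p∣; x∉p⇒x∈∁p)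
open import Data.Fin.Subset.Induction using (⊂-wellFounded)
open import Data.Vec using ([]; _∷_; here; there; tabulate)
open import Data.Vec.Properties using (lookup∘tabulate; lookup⇒[]=; []=⇒lookup)
open import Data.Product using (Σ; ∃; _×_; _,_; proj₁; proj₂)
open import Data.Sum using (_⊎_; inj₁; inj₂)
open import Data.Empty using (⊥-elim)
open import Function using (_∘_)
open import Induction.WellFounded using (Acc; acc)
open import Relation.Nullary using (¬_; yes; no; does; contradiction)
open import Relation.Nullary.Decidable
  using (_×-dec_; _⊎-dec_; _→-dec_; ¬?; decidable-stable; dec-true)
open import Relation.Unary using (Pred; Decidable)
open import Relation.Binary.PropositionalEquality
  using (_≡_; _≢_; refl; sym; trans; cong)

-- Subsets cut out by decidable predicates, and counting by injection.

comprehension : ∀ {n ℓ} {P : Pred (Fin n) ℓ} → Decidable P → Subset n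
comprehension P? = tabulate (does ∘ P?)

∈-comprehension⁺ : ∀ {n ℓ} {P : Pred (Fin n) ℓ} (P? : Decidable P) {x} →
                   P x → x ∈ comprehension P?
∈-comprehension⁺ P? {x} px =
  lookup⇒[]= x _ (trans (lookup∘tabulate (does ∘ P?) x) (dec-true (P? x) px))

∈-comprehension⁻ : ∀ {n ℓ} {P : Pred (Fin n) ℓ} (P? : Decidable P) {x} →
                   x ∈ comprehension P? → P x
∈-comprehension⁻ P? {x} x∈
  with P? x | trans (sym (lookup∘tabulate (does ∘ P?) x)) ([]=⇒lookup x∈)
... | yes px | _ = px
... | no _   | ()

-- The partner chosen for the head of `p` is removed from `q`; injectivity keeps every later element
-- from needing it. The recursion shortens `p` but not `q`, hence the separate `m` and `n`.
injective-relation⇒∣p∣≤∣q∣ :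
  ∀ {m n} (p : Subset m) (q : Subset n) (R : Fin m → Fin n → Set) →
  (∀ {a} → a ∈ p → ∃ λ x → x ∈ q × R a x) →
  (∀ {a b x} → a ∈ p → b ∈ p → R a x → R b x → a ≡ b) →
  ∣ p ∣ ≤ ∣ q ∣
injective-relation⇒∣p∣≤∣q∣ [] q R total inj = z≤n
injective-relation⇒∣p∣≤∣q∣ (outside ∷ p) q R total inj =
  injective-relation⇒∣p∣≤∣q∣ p q (R ∘ suc) (total ∘ there)
    (λ a∈p b∈p r s → suc-injective (inj (there a∈p) (there b∈p) r s))
injective-relation⇒∣p∣≤∣q∣ (inside ∷ p) q R total inj with total here
... | x₀ , x₀∈q , r₀ =
  ≤-trans
    (s≤s (injective-relation⇒∣p∣≤∣q∣ p (q - x₀) (R ∘ suc) total′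
      (λ a∈p b∈p r s → suc-injective (inj (there a∈p) (there b∈p) r s))))
    (x∈p⇒∣p-x∣<∣p∣ x₀∈q)
  where
  total′ : ∀ {a} → a ∈ p → ∃ λ x → x ∈ q - x₀ × R (suc a) x
  total′ a∈p with total (there a∈p)
  ... | x , x∈q , r = x , x∈p∧x≢y⇒x∈p-y x∈q x≢x₀ , r
    where
    x≢x₀ : x ≢ x₀
    x≢x₀ refl = 0≢1+n (inj here (there a∈p) r₀ r)

module _ {n : ℕ} (D : Digraph n) where

  -- Existence of a quasi-kernel.

  Absorbs : Subset n → Fin n → Set
  Absorbs Q v = Σ (Fin n) (λ q → q ∈ Q × Reach≤2 D v q)

  -- Delete some s and its in-neighbours; in the quasi-kernel of the rest, s is added
  -- unless it already has an arc into it.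
  quasiKernelOf : ∀ S → Acc _⊂_ S →
    Σ (Subset n) λ Q → Q ⊆ S × Independent D Q × (∀ v → v ∈ S → v ∉ Q → Absorbs Q v)
  quasiKernelOf S (acc rec) with any? (_∈? S)
  ... | no empty = S , (λ v∈S → v∈S) , (λ u _ u∈S _ _ → empty (u , u∈S)) ,
    λ v v∈S v∉S → contradiction v∈S v∉S
  ... | yes (s , s∈S) = extend (quasiKernelOf S′ (rec S′⊂S))
    where
    Far? : Decidable (λ v → v ∈ S × v ≢ s × ¬ Arc D v s)
    Far? v = v ∈? S ×-dec ¬? (v ≟ s) ×-dec ¬? (arc? D v s)
    S′ : Subset n
    S′ = comprehension Far?
    S′⊂S : S′ ⊂ S
    S′⊂S = (proj₁ ∘ ∈-comprehension⁻ Far?) , s , s∈S ,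
      λ s∈S′ → proj₁ (proj₂ (∈-comprehension⁻ Far? s∈S′)) refl
    extend : (Σ (Subset n) λ Q → Q ⊆ S′ × Independent D Q × (∀ v → v ∈ S′ → v ∉ Q → Absorbs Q v)) →
             Σ (Subset n) λ Q → Q ⊆ S × Independent D Q × (∀ v → v ∈ S → v ∉ Q → Absorbs Q v)
    extend (Q , Q⊆S′ , ind , abs) with any? (λ q → q ∈? Q ×-dec arc? D s q)
    ... | yes (q , q∈Q , s→q) = Q , (proj₁ S′⊂S ∘ Q⊆S′) , ind , abs′
      where
      abs′ : ∀ v → v ∈ S → v ∉ Q → Absorbs Q v
      abs′ v v∈S v∉Q with v ≟ s
      ... | yes refl = q , q∈Q , inj₁ s→q
      ... | no v≢s with arc? D v s
      -- A deleted in-neighbour of `s` reaches `Q` in two steps, with `s` as the midpoint.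
      ...   | yes v→s = q , q∈Q , inj₂ (s , v→s , s→q)
      ...   | no v↛s = abs v (∈-comprehension⁺ Far? (v∈S , v≢s , v↛s)) v∉Q
    ... | no s↛Q = Q⁺ , Q⁺⊆S , ind′ , abs′
      where
      Q⁺? : Decidable (λ v → v ≡ s ⊎ v ∈ Q)
      Q⁺? v = v ≟ s ⊎-dec v ∈? Q
      Q⁺ : Subset n
      Q⁺ = comprehension Q⁺?
      Q⁺⊆S : Q⁺ ⊆ S
      Q⁺⊆S v∈Q⁺ with ∈-comprehension⁻ Q⁺? v∈Q⁺
      ... | inj₁ refl = s∈S
      ... | inj₂ v∈Q = proj₁ S′⊂S (Q⊆S′ v∈Q)
      ind′ : Independent D Q⁺
      ind′ u v u∈ v∈ u→v with ∈-comprehension⁻ Q⁺? u∈ | ∈-comprehension⁻ Q⁺? v∈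
      ... | inj₁ refl | inj₁ refl = loopless D s u→v
      ... | inj₁ refl | inj₂ v∈Q = s↛Q (v , v∈Q , u→v)
      ... | inj₂ u∈Q | inj₁ refl = proj₂ (proj₂ (∈-comprehension⁻ Far? (Q⊆S′ u∈Q))) u→v
      ... | inj₂ u∈Q | inj₂ v∈Q = ind u v u∈Q v∈Q u→v
      abs′ : ∀ v → v ∈ S → v ∉ Q⁺ → Absorbs Q⁺ v
      abs′ v v∈S v∉Q⁺ with arc? D v s
      ... | yes v→s = s , ∈-comprehension⁺ Q⁺? (inj₁ refl) , inj₁ v→s
      ... | no v↛s
        with abs v (∈-comprehension⁺ Far? (v∈S , v∉Q⁺ ∘ ∈-comprehension⁺ Q⁺? ∘ inj₁ , v↛s))
                   (v∉Q⁺ ∘ ∈-comprehension⁺ Q⁺? ∘ inj₂)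
      ...   | q , q∈Q , reach = q , ∈-comprehension⁺ Q⁺? (inj₂ q∈Q) , reach

  chvátal-lovász : Σ (Subset n) (QuasiKernel D)
  chvátal-lovász with quasiKernelOf ⊤ (⊂-wellFounded ⊤)
  ... | Q , _ , ind , abs = Q , ind , λ v → abs v ∈⊤

  -- Remote vertices and the exchange argument.

  ArcInto : Subset n → Fin n → Set
  ArcInto Q v = Σ (Fin n) λ q → q ∈ Q × Arc D v q

  arcInto? : ∀ Q → Decidable (ArcInto Q)
  arcInto? Q v = any? λ q → q ∈? Q ×-dec arc? D v q

  Remote : Subset n → Fin n → Set
  Remote Q c = c ∉ Q × ¬ ArcInto Q c

  remote? : ∀ Q → Decidable (Remote Q)
  remote? Q c = ¬? (c ∈? Q) ×-dec ¬? (arcInto? Q c)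

  -- These are the obstructions to a swap at `c`: vertices that lose all their arcs into `Q` once
  -- the in-neighbours of `c` are deleted from it.
  Confined : Subset n → Fin n → Fin n → Set
  Confined Q c v = ArcInto Q v × (∀ q → q ∈ Q → Arc D v q → Arc D q c)

  confined? : ∀ Q c → Decidable (Confined Q c)
  confined? Q c v =
    arcInto? Q v ×-dec all? λ q → q ∈? Q →-dec arc? D v q →-dec arc? D q c

  Saturated : Subset n → Set
  Saturated Q = ∀ c → Remote Q c → ∃ (Confined Q c)

  swap : ∀ {Q c} → QuasiKernel D Q → Remote Q c → ¬ ∃ (Confined Q c) →
         Σ (Subset n) λ Q′ → QuasiKernel D Q′ ×
           comprehension (remote? Q′) ⊂ comprehension (remote? Q)
  swap {Q} {c} (ind , abs) rem@(c∉Q , c↛Q) unconfined =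
    Q′ , (ind′ , abs′) , remote⊆ , c , ∈-comprehension⁺ (remote? Q) rem ,
    λ c∈ → proj₁ (∈-comprehension⁻ (remote? Q′) c∈) c∈Q′
    where
    Q′? : Decidable (λ v → v ≡ c ⊎ v ∈ Q × ¬ Arc D v c)
    Q′? v = v ≟ c ⊎-dec v ∈? Q ×-dec ¬? (arc? D v c)
    Q′ : Subset n
    Q′ = comprehension Q′?
    c∈Q′ : c ∈ Q′
    c∈Q′ = ∈-comprehension⁺ Q′? (inj₁ refl)

    ind′ : Independent D Q′
    ind′ u v u∈ v∈ u→v with ∈-comprehension⁻ Q′? u∈ | ∈-comprehension⁻ Q′? v∈
    ... | inj₁ refl | inj₁ refl = loopless D c u→v
    ... | inj₁ refl | inj₂ (v∈Q , _) = c↛Q (v , v∈Q , u→v)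
    ... | inj₂ (_ , u↛c) | inj₁ refl = u↛c u→v
    ... | inj₂ (u∈Q , _) | inj₂ (v∈Q , _) = ind u v u∈Q v∈Q u→v

    -- If all out-neighbours of `v` in `Q` had an arc to `c`, then `v` would be confined; so one of
    -- them survives in `Q′`.
    arcInto′ : ∀ {v} → ArcInto Q v → ArcInto Q′ v
    arcInto′ {v} v→Q with any? (λ q → q ∈? Q ×-dec arc? D v q ×-dec ¬? (arc? D q c))
    ... | yes (q , q∈Q , v→q , q↛c) = q , ∈-comprehension⁺ Q′? (inj₂ (q∈Q , q↛c)) , v→q
    ... | no none = contradiction
      (v , v→Q , λ q q∈Q v→q → decidable-stable (arc? D q c) λ q↛c → none (q , q∈Q , v→q , q↛c))
      unconfined

    fromQ : ∀ {v} → v ∈ Q → v ∉ Q′ → Arc D v c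
    fromQ {v} v∈Q v∉Q′ = decidable-stable (arc? D v c) λ v↛c →
      v∉Q′ (∈-comprehension⁺ Q′? (inj₂ (v∈Q , v↛c)))

    direct : ∀ {v} → ArcInto Q′ v → Absorbs Q′ v
    direct (q , q∈ , v→q) = q , q∈ , inj₁ v→q

    abs′ : ∀ v → v ∉ Q′ → Absorbs Q′ v
    abs′ v v∉Q′ with v ∈? Q
    ... | yes v∈Q = c , c∈Q′ , inj₁ (fromQ v∈Q v∉Q′)
    ... | no v∉Q with abs v v∉Q
    ...   | q , q∈Q , inj₁ v→q = direct (arcInto′ (q , q∈Q , v→q))
    ...   | q , q∈Q , inj₂ (x , v→x , x→q) with arcInto′ (q , q∈Q , x→q)
    ...     | q′ , q′∈ , x→q′ = q′ , q′∈ , inj₂ (x , v→x , x→q′)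

    -- A vertex deleted from `Q` has an arc to `c`, which lies in `Q′`, so deletion creates no
    -- remote vertex; `arcInto′` handles the vertices with an arc into `Q`.
    remote⊆ : comprehension (remote? Q′) ⊆ comprehension (remote? Q)
    remote⊆ {v} v∈ with ∈-comprehension⁻ (remote? Q′) v∈
    ... | v∉Q′ , v↛Q′ = ∈-comprehension⁺ (remote? Q)
      ((λ v∈Q → v↛Q′ (c , c∈Q′ , fromQ v∈Q v∉Q′)) , v↛Q′ ∘ arcInto′)

  -- Minimality is realised by descent: each swap strictly shrinks the set of remote vertices, and
  -- when no swap applies the set is saturated.
  saturate : ∀ Q → Acc _⊂_ (comprehension (remote? Q)) → QuasiKernel D Q →
             Σ (Subset n) λ Q′ → QuasiKernel D Q′ × Saturated Q′
  saturate Q (acc rec) qk with any? (λ c → remote? Q c ×-dec ¬? (any? (confined? Q c)))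
  ... | yes (c , rem , unconfined) with swap qk rem unconfined
  ...   | Q′ , qk′ , smaller = saturate Q′ (rec smaller) qk′
  saturate Q (acc rec) qk | no none = Q , qk , λ c rem →
    decidable-stable (any? (confined? Q c)) λ unconfined → none (c , rem , unconfined)

  -- Thinning a saturated quasi-kernel to at most half of the vertices.

  outNeighbour : SinkFree D → ∀ v → ∃ (Arc D v)
  outNeighbour sinkFree v = decidable-stable (any? (arc? D v)) λ none →
    sinkFree v λ w v→w → none (w , v→w)

  module Half (sinkFree : SinkFree D) (antiClawFree : AntiClawFree D)
              (Q : Subset n) (qk : QuasiKernel D Q) (saturated : Saturated Q) where

    ind : Independent D Q
    ind = proj₁ qk

    -- Equal to v itself, an irrelevant value, when v has no arc into Q.
    sel : Fin n → Fin n
    sel v with arcInto? Q v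
    ... | yes (q , _) = q
    ... | no _ = v

    sel-spec : ∀ {v} → ArcInto Q v → sel v ∈ Q × Arc D v (sel v)
    sel-spec {v} v→Q with arcInto? Q v
    ... | yes (_ , spec) = spec
    ... | no v↛Q = contradiction v→Q v↛Q

    Hit : Fin n → Set
    Hit a = ∃ λ v → ArcInto Q v × sel v ≡ a

    hit? : Decidable Hit
    hit? a = any? λ v → arcInto? Q v ×-dec sel v ≟ a

    Kept : Fin n → Set
    Kept a = a ∈ Q × (Hit a ⊎ (∀ w → Arc D a w → ¬ ArcInto Q w))

    kept? : Decidable Kept
    kept? a = a ∈? Q ×-dec (hit? a ⊎-dec all? λ w → arc? D a w →-dec ¬? (arcInto? Q w))

    A : Subset n
    A = comprehension kept?

    A⊆Q : A ⊆ Q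
    A⊆Q = proj₁ ∘ ∈-comprehension⁻ kept?

    sel∈A : ∀ {v} → ArcInto Q v → sel v ∈ A
    sel∈A {v} v→Q = ∈-comprehension⁺ kept? (proj₁ (sel-spec v→Q) , inj₁ (v , v→Q , refl))

    -- Any path ending with an arc from `x` into `Q` can be redirected to end at `sel x`. A vertex
    -- dropped from `Q` has an out-neighbour `w` with an arc into `Q`, hence a path of two arcs to
    -- `sel w`.
    A-quasiKernel : QuasiKernel D A
    A-quasiKernel = (λ u v u∈A v∈A → ind u v (A⊆Q u∈A) (A⊆Q v∈A)) , abs
      where
      viaN : ∀ {v w} → Arc D v w → ArcInto Q w → Absorbs A v
      viaN {w = w} v→w w→Q = sel w , sel∈A w→Q , inj₂ (w , v→w , proj₂ (sel-spec w→Q))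

      abs : ∀ v → v ∉ A → Absorbs A v
      abs v v∉A with v ∈? Q
      ... | yes v∈Q with any? (λ w → arc? D v w ×-dec arcInto? Q w)
      ...   | yes (w , v→w , w→Q) = viaN v→w w→Q
      ...   | no none = contradiction
        (∈-comprehension⁺ kept? (v∈Q , inj₂ λ w v→w w→Q → none (w , v→w , w→Q))) v∉A
      abs v v∉A | no v∉Q with proj₂ qk v v∉Q
      ...   | q , q∈Q , inj₁ v→q = sel v , sel∈A v→Q , inj₁ (proj₂ (sel-spec v→Q))
        where v→Q = q , q∈Q , v→q
      ...   | q , q∈Q , inj₂ (x , v→x , x→q) = viaN v→x (q , q∈Q , x→q)

    -- Since `Q` is independent and a remote `c` has no arc back into it, three distinct
    -- in-neighbours in `Q` would form an induced anti-claw with `c`.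
    in-neighbours-≤2 : ∀ {a b d c} → a ∈ Q → b ∈ Q → d ∈ Q → Remote Q c →
      Arc D a c → Arc D b c → Arc D d c → a ≢ b → d ≡ a ⊎ d ≡ b
    in-neighbours-≤2 {a} {b} {d} {c} a∈ b∈ d∈ (c∉ , c↛) a→c b→c d→c a≢b with d ≟ a | d ≟ b
    ... | yes d≡a | _ = inj₁ d≡a
    ... | no _ | yes d≡b = inj₂ d≡b
    ... | no d≢a | no d≢b = ⊥-elim (antiClawFree a b d c
      ( a≢b , d≢a ∘ sym , d≢b ∘ sym , distinct a∈ , distinct b∈ , distinct d∈
      , a→c , b→c , d→c , noBack a∈ , noBack b∈ , noBack d∈
      , ind a b a∈ b∈ , ind b a b∈ a∈ , ind a d a∈ d∈ , ind d a d∈ a∈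
      , ind b d b∈ d∈ , ind d b d∈ b∈))
      where
      distinct : ∀ {x} → x ∈ Q → x ≢ c
      distinct x∈ refl = c∉ x∈
      noBack : ∀ {x} → x ∈ Q → ¬ Arc D c x
      noBack {x} x∈ c→x = c↛ (x , x∈ , c→x)

    -- For the confined `v` given by saturation, `sel v` is an in-neighbour of `c`. Were `a` and `b`
    -- distinct, `sel v` would have to be one of them, which would then be hit.
    unhit-unique : ∀ {a b c} → a ∈ Q → b ∈ Q → Remote Q c → Arc D a c → Arc D b c →
      ¬ Hit a → ¬ Hit b → a ≡ b
    unhit-unique {a} {b} {c} a∈ b∈ rem a→c b→c a-unhit b-unhit =
      decidable-stable (a ≟ b) λ a≢b → go a≢b (saturated c rem)
      where
      go : a ≢ b → ¬ ∃ (Confined Q c)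
      go a≢b (v , v→Q , conf) with sel-spec v→Q
      ... | s∈Q , v→s with in-neighbours-≤2 a∈ b∈ s∈Q rem a→c b→c (conf (sel v) s∈Q v→s) a≢b
      ...   | inj₁ s≡a = a-unhit (v , v→Q , s≡a)
      ...   | inj₂ s≡b = b-unhit (v , v→Q , s≡b)

    -- Partners of the first kind have an arc into `Q` and those of the second are remote, so the
    -- kinds never collide. `¬ Hit a` is recorded for `unhit-unique`.
    Match : Fin n → Fin n → Set
    Match a x = (ArcInto Q x × sel x ≡ a) ⊎ (Remote Q x × Arc D a x × ¬ Hit a)

    match-total : ∀ {a} → a ∈ A → ∃ λ x → x ∈ ∁ A × Match a x
    match-total {a} a∈A with ∈-comprehension⁻ kept? a∈A | hit? a
    ... | _ | yes (v , v→Q@(q , q∈Q , v→q) , sv≡a) =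
      v , x∉p⇒x∈∁p (λ v∈A → ind v q (A⊆Q v∈A) q∈Q v→q) , inj₁ (v→Q , sv≡a)
    ... | _ , inj₁ a-hit | no a-unhit = contradiction a-hit a-unhit
    -- Any out-neighbour serves: independence puts it outside `Q`, and `a↛N` denies it an arc into
    -- `Q`, so it is remote.
    ... | a∈Q , inj₂ a↛N | no a-unhit with outNeighbour sinkFree a
    ...   | c , a→c = c , x∉p⇒x∈∁p (c∉Q ∘ A⊆Q) , inj₂ ((c∉Q , a↛N c a→c) , a→c , a-unhit)
      where
      c∉Q : c ∉ Q
      c∉Q c∈Q = ind a c a∈Q c∈Q a→c

    match-injective : ∀ {a b x} → a ∈ A → b ∈ A → Match a x → Match b x → a ≡ b
    match-injective _ _ (inj₁ (_ , s≡a)) (inj₁ (_ , s≡b)) = trans (sym s≡a) s≡b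
    match-injective _ _ (inj₁ (x→Q , _)) (inj₂ ((_ , x↛Q) , _)) = contradiction x→Q x↛Q
    match-injective _ _ (inj₂ ((_ , x↛Q) , _)) (inj₁ (x→Q , _)) = contradiction x→Q x↛Q
    match-injective a∈A b∈A (inj₂ (rem , a→x , a-unhit)) (inj₂ (_ , b→x , b-unhit)) =
      unhit-unique (A⊆Q a∈A) (A⊆Q b∈A) rem a→x b→x a-unhit b-unhit

    2∣A∣≤n : 2 * ∣ A ∣ ≤ n
    2∣A∣≤n = begin
      2 * ∣ A ∣             ≡⟨ cong (∣ A ∣ +_) (+-identityʳ ∣ A ∣) ⟩
      ∣ A ∣ + ∣ A ∣         ≤⟨ +-monoʳ-≤ ∣ A ∣
                                (injective-relation⇒∣p∣≤∣q∣ A (∁ A) Match match-total match-injective) ⟩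
      ∣ A ∣ + ∣ ∁ A ∣       ≡⟨ cong (∣ A ∣ +_) (∣∁p∣≡n∸∣p∣ A) ⟩
      ∣ A ∣ + (n ∸ ∣ A ∣)   ≡⟨ m+[n∸m]≡n (∣p∣≤n A) ⟩
      n                     ∎
      where open ≤-Reasoning

theorem1 : (n : ℕ) (D : Digraph n) → SinkFree D → AntiClawFree D →
    Σ (Subset n) (λ Q → QuasiKernel D Q × 2 * ∣ Q ∣ ≤ n)
theorem1 n D sinkFree antiClawFree with chvátal-lovász D
... | Q₀ , qk₀ with saturate D Q₀ (⊂-wellFounded _) qk₀
...   | Q , qk , saturated = A , A-quasiKernel , 2∣A∣≤n
  where open Half D sinkFree antiClawFree Q qk saturated
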